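{- For all non-negative integers $m$ and $k$, $$\sum_{n=0}^m \binom{m}{n}\binom{m+n+k}{m}\binom{2m+n+k}{n+m}^{ -1}\frac{m+2n+k+1}{2m+n+k+1}=1.$$
   Context: Here $\binom{a}{b}$ denotes the usual binomial coefficient, and $\binom{a}{b}^{ -1}$ its multiplicative inverse (as a rational number). -}

module Defs where

open import Data.Fin.Base using (toℕ)
open import Data.Integer.Base using (+_)
open import Data.Nat.Base as ℕ using (ℕ; zero; suc; _≤_; z≤n; s≤s)
open import Data.Nat.Combinatorics using (_C_; nCk+nC[k+1]≡[n+1]C[k+1])
import Data.Nat.Properties as ℕ
open import Data.Rational.Base as ℚ using (ℚ; _/_; 1/_)
open import Data.Rational.Properties as ℚ using (normalize-pos; pos⇒nonZero)
import Algebra.Properties.CommutativeMonoid.Sum ℚ.+-0-commutativeMonoid as Sum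
open import Relation.Binary.PropositionalEquality using (subst)

-- Both endpoints are included: 0 ≤ n ≤ m.
∑₀ : (m : ℕ) → (ℕ → ℚ) → ℚ
∑₀ m f = Sum.sum {suc m} (λ i → f (toℕ i))

syntax ∑₀ m (λ n → e) = ∑[ n ≤ m ] e

infixl 6 ∑₀

C-positive : ∀ a b → b ≤ a → 0 ℕ.< a C b
C-positive a       zero    _         = s≤s z≤n
C-positive (suc a) (suc b) (s≤s b≤a) =
  subst (0 ℕ.<_) (nCk+nC[k+1]≡[n+1]C[k+1] a b)
    (ℕ.≤-trans (C-positive a b b≤a) (ℕ.m≤m+n (a C b) (a C suc b)))

binom : ℕ → ℕ → ℚ
binom a b = + (a C b) / 1

binom-nonZero : ∀ a b → b ≤ a → ℚ.NonZero (binom a b)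
binom-nonZero a b b≤a = pos⇒nonZero (binom a b)
  where instance
    _ = ℕ.>-nonZero (C-positive a b b≤a)
    _ = normalize-pos (a C b) 1

-- 1/_ has no value at 0, so the inverse is only available for b ≤ a.
binom⁻¹ : (a b : ℕ) → .(b ≤ a) → ℚ
binom⁻¹ a b b≤a = 1/_ (binom a b) {{binom-nonZero a b b≤a}}

n+m≤2m+n+k : ∀ m n k → n ℕ.+ m ≤ 2 ℕ.* m ℕ.+ n ℕ.+ k
n+m≤2m+n+k m n k = begin
  n ℕ.+ m                  ≡⟨ ℕ.+-comm n m ⟩
  m ℕ.+ n                  ≤⟨ ℕ.+-monoˡ-≤ n (ℕ.m≤m+n m (1 ℕ.* m)) ⟩
  2 ℕ.* m ℕ.+ n            ≤⟨ ℕ.m≤m+n _ k ⟩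
  2 ℕ.* m ℕ.+ n ℕ.+ k      ∎
  where open ℕ.≤-Reasoning

{-# OPTIONS --safe #-}

-- Write F(m,k,n) for the summand.  Up to the factors that it shares with its
-- neighbours it is very well-poised in a = m + k + 1, and
--   F(m+1,k,n) + G(n+1) = F(m,k+1,n) + G(n)
-- for a certificate G vanishing at both ends of the summation range.  The sum
-- therefore depends only on m + k, and for m = 0 it is the single term 1.

module Submission where

open import Defs
open import Data.Integer.Base as ℤ using (+_)
import Data.Integer.Properties as ℤ
open import Data.Nat.Base using (ℕ; zero; suc; _+_; _∸_; _≤_; z≤n; s≤s; _!; NonZero; >-nonZero) renaming (_*_ to _·_)
open import Data.Nat.Combinatorics
  using (_C_; nCk+nC[k+1]≡[n+1]C[k+1]; nCk≡n!/k![n-k]!; k![n∸k]!∣n!; k>n⇒nCk≡0)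
open import Data.Nat.DivMod using (m/n*n≡m)
import Data.Nat.Properties as ℕ
open import Data.Nat.Tactic.RingSolver using (solve-∀)
open import Data.Rational.Base using (ℚ; 0ℚ; 1ℚ; _/_; _*_; 1/_; toℚᵘ) renaming (_+_ to _⊕_; NonZero to NonZeroℚ)
import Data.Rational.Properties as ℚ
open import Data.Rational.Unnormalised.Base as ℚᵘ using (mkℚᵘ; *≡*)
import Data.Rational.Unnormalised.Properties as ℚᵘ
open import Function.Base using (_∘_; it)
open import Relation.Binary.PropositionalEquality

-- Arithmetic of fractions of natural numbers.

-- `_/_` reduces to lowest terms, so the equality is proved on unnormalised fractions, where it
-- means cross multiplication.
/-cross : ∀ a b c d .{{_ : NonZero b}} .{{_ : NonZero d}} →
          a · d ≡ c · b → + a / b ≡ + c / d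
/-cross a (suc b) c (suc d) eq = ℚ.fromℚᵘ-cong {mkℚᵘ (+ a) b} {mkℚᵘ (+ c) d} (*≡* (begin
  + a ℤ.* + suc d   ≡⟨ ℤ.pos-* a (suc d) ⟨
  + (a · suc d)     ≡⟨ cong +_ eq ⟩
  + (c · suc b)     ≡⟨ ℤ.pos-* c (suc b) ⟩
  + c ℤ.* + suc b   ∎))
  where open ≡-Reasoning

/-* : ∀ a b c d .{{_ : NonZero b}} .{{_ : NonZero d}} .{{_ : NonZero (b · d)}} →
      (+ a / b) * (+ c / d) ≡ + (a · c) / (b · d)
/-* a (suc b) c (suc d) = ℚ.toℚᵘ-injective (begin
  toℚᵘ ((+ a / suc b) * (+ c / suc d))          ≈⟨ ℚ.toℚᵘ-homo-* (+ a / suc b) (+ c / suc d) ⟩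
  toℚᵘ (+ a / suc b) ℚᵘ.* toℚᵘ (+ c / suc d)    ≈⟨ ℚᵘ.*-cong (ℚ.toℚᵘ-fromℚᵘ (mkℚᵘ (+ a) b)) (ℚ.toℚᵘ-fromℚᵘ (mkℚᵘ (+ c) d)) ⟩
  mkℚᵘ (+ a) b ℚᵘ.* mkℚᵘ (+ c) d                ≈⟨ *≡* (cong (ℤ._* + (suc b · suc d)) (sym (ℤ.pos-* a c))) ⟩
  mkℚᵘ (+ (a · c)) (d + b · suc d)              ≈⟨ ℚ.toℚᵘ-fromℚᵘ (mkℚᵘ (+ (a · c)) (d + b · suc d)) ⟨
  toℚᵘ (+ (a · c) / (suc b · suc d))            ∎)
  where open ℚᵘ.≃-Reasoning

-- Pulling out `+ 1 / d` by distributivity leaves a sum with denominator 1, so the common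
-- denominator never gets squared.
/-+ : ∀ a b d .{{_ : NonZero d}} → (+ a / d) ⊕ (+ b / d) ≡ + (a + b) / d
/-+ a b d = begin
  (+ a / d) ⊕ (+ b / d)                      ≡⟨ cong₂ _⊕_ (split a) (split b) ⟩
  (+ a / 1) * (+ 1 / d) ⊕ (+ b / 1) * (+ 1 / d)   ≡⟨ ℚ.*-distribʳ-+ (+ 1 / d) (+ a / 1) (+ b / 1) ⟨
  ((+ a / 1) ⊕ (+ b / 1)) * (+ 1 / d)        ≡⟨ cong (_* (+ 1 / d)) integral ⟩
  (+ (a + b) / 1) * (+ 1 / d)                ≡⟨ split (a + b) ⟨
  + (a + b) / d                              ∎
  where
  open ≡-Reasoning
  instance 1·d≢0 = ℕ.m*n≢0 1 d
  split : ∀ x → + x / d ≡ (+ x / 1) * (+ 1 / d)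
  split x = sym (trans (/-* x 1 1 d) (/-cross (x · 1) (1 · d) x d (arith x d)))
    where
    arith : ∀ x d → x · 1 · d ≡ x · (1 · d)
    arith = solve-∀
  integral : (+ a / 1) ⊕ (+ b / 1) ≡ + (a + b) / 1
  integral = ℚ.toℚᵘ-injective (R.begin
    toℚᵘ ((+ a / 1) ⊕ (+ b / 1))              R.≈⟨ ℚ.toℚᵘ-homo-+ (+ a / 1) (+ b / 1) ⟩
    toℚᵘ (+ a / 1) ℚᵘ.+ toℚᵘ (+ b / 1)        R.≈⟨ ℚᵘ.+-cong (ℚ.toℚᵘ-fromℚᵘ (mkℚᵘ (+ a) 0)) (ℚ.toℚᵘ-fromℚᵘ (mkℚᵘ (+ b) 0)) ⟩
    mkℚᵘ (+ a) 0 ℚᵘ.+ mkℚᵘ (+ b) 0            R.≈⟨ *≡* (cong (ℤ._* + 1) (cong₂ ℤ._+_ (ℤ.*-identityʳ (+ a)) (ℤ.*-identityʳ (+ b)))) ⟩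
    mkℚᵘ (+ (a + b)) 0                        R.≈⟨ ℚ.toℚᵘ-fromℚᵘ (mkℚᵘ (+ (a + b)) 0) ⟨
    toℚᵘ (+ (a + b) / 1)                      R.∎)
    where module R = ℚᵘ.≃-Reasoning

1/-unique : ∀ p q .{{_ : NonZeroℚ p}} → q * p ≡ 1ℚ → 1/ p ≡ q
1/-unique p q qp≡1 = begin
  1/ p              ≡⟨ ℚ.*-identityˡ (1/ p) ⟨
  1ℚ * 1/ p         ≡⟨ cong (_* 1/ p) qp≡1 ⟨
  q * p * 1/ p      ≡⟨ ℚ.*-assoc q p (1/ p) ⟩
  q * (p * 1/ p)    ≡⟨ cong (q *_) (ℚ.*-inverseʳ p) ⟩
  q * 1ℚ            ≡⟨ ℚ.*-identityʳ q ⟩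
  q                 ∎
  where open ≡-Reasoning

binom⁻¹-/ : ∀ a b .(b≤a : b ≤ a) .{{_ : NonZero (a C b)}} → binom⁻¹ a b b≤a ≡ + 1 / (a C b)
binom⁻¹-/ a b b≤a = 1/-unique (binom a b) (+ 1 / (a C b)) {{binom-nonZero a b b≤a}}
  (trans (/-* 1 (a C b) (a C b) 1) (/-cross (1 · (a C b)) ((a C b) · 1) 1 1 (arith (a C b))))
  where
  instance C·1≢0 = ℕ.m*n≢0 (a C b) 1
  arith : ∀ x → 1 · x · 1 ≡ 1 · (x · 1)
  arith = solve-∀

-- Binomial coefficients: factorials, Pascal's rule and absorption.

[a+b]Ca·a!b!≡[a+b]! : ∀ a b → ((a + b) C a) · (a ! · b !) ≡ (a + b) !
[a+b]Ca·a!b!≡[a+b]! a b = begin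
  ((a + b) C a) · (a ! · b !)              ≡⟨ cong (λ x → ((a + b) C a) · (a ! · x !)) (ℕ.m+n∸m≡n a b) ⟨
  ((a + b) C a) · (a ! · (a + b ∸ a) !)    ≡⟨ cong (_· (a ! · (a + b ∸ a) !)) (nCk≡n!/k![n-k]! (ℕ.m≤m+n a b)) ⟩
  _                                        ≡⟨ m/n*n≡m (k![n∸k]!∣n! (ℕ.m≤m+n a b)) ⟩
  (a + b) !                                ∎
  where
  open ≡-Reasoning
  instance a![a+b∸a]!≢0 = a ℕ.!* (a + b ∸ a) !≢0

-- The coefficient `m C (n - 1)`, read as 0 at `n = 0`. Truncated subtraction would give 1 there and
-- break both Pascal's rule and the vanishing of `G` at the lower end.
C⁻ : ℕ → ℕ → ℕ
C⁻ m zero    = 0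
C⁻ m (suc n) = m C n

pascal : ∀ m n → suc m C n ≡ m C n + C⁻ m n
pascal m zero    = refl
pascal m (suc n) = trans (sym (nCk+nC[k+1]≡[n+1]C[k+1] m n)) (ℕ.+-comm (m C n) (m C suc n))

-- Induction on `m`: Pascal's rule splits the left side, the hypothesis is used at both `suc n` and
-- `n`, and Pascal's rule reassembles the result. Unlike cancelling factorials, this also covers
-- `n > suc m`.
absorption : ∀ m n → n · (suc m C n) ≡ suc m · C⁻ m n
absorption m       zero          = sym (ℕ.*-zeroʳ (suc m))
absorption zero    (suc zero)    = refl
absorption zero    (suc (suc n)) = begin
  suc (suc n) · (1 C suc (suc n))  ≡⟨ cong (suc (suc n) ·_) (k>n⇒nCk≡0 {1} {suc (suc n)} (s≤s (s≤s z≤n))) ⟩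
  suc (suc n) · 0                  ≡⟨ ℕ.*-zeroʳ (suc (suc n)) ⟩
  0                                ≡⟨ cong (1 ·_) (k>n⇒nCk≡0 {0} {suc n} (s≤s z≤n)) ⟨
  1 · (0 C suc n)                  ∎
  where open ≡-Reasoning
absorption (suc m) (suc n) = begin
  suc n · (suc (suc m) C suc n)                       ≡⟨ cong (suc n ·_) (pascal (suc m) (suc n)) ⟩
  suc n · (suc m C suc n + suc m C n)                 ≡⟨ expand n (suc m C suc n) (suc m C n) ⟩
  suc n · (suc m C suc n) + n · (suc m C n) + suc m C n
    ≡⟨ cong (_+ suc m C n) (cong₂ _+_ (absorption m (suc n)) (absorption m n)) ⟩
  suc m · (m C n) + suc m · C⁻ m n + suc m C n        ≡⟨ cong (_+ suc m C n) (ℕ.*-distribˡ-+ (suc m) (m C n) (C⁻ m n)) ⟨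
  suc m · (m C n + C⁻ m n) + suc m C n                ≡⟨ cong (λ x → suc m · x + suc m C n) (pascal m n) ⟨
  suc m · (suc m C n) + suc m C n                     ≡⟨ ℕ.+-comm (suc m · (suc m C n)) (suc m C n) ⟩
  suc (suc m) · (suc m C n)                           ∎
  where
  open ≡-Reasoning
  expand : ∀ n x y → suc n · (x + y) ≡ suc n · x + n · y + y
  expand = solve-∀

-- Fractions over a product of three factorials.

factorials≢0 : ∀ p q r → NonZero (p ! · q ! · r !)
factorials≢0 p q r = ℕ.m*n≢0 (p ! · q !) (r !) {{p ℕ.!* q !≢0}} {{r ℕ.!≢0}}

infix 8 _/!_,_,_

-- Opaque so that unification can read off the arguments.
opaque
  _/!_,_,_ : ℕ → ℕ → ℕ → ℕ → ℚ
  a /! p , q , r = (+ a / (p ! · q ! · r !)) {{factorials≢0 p q r}}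

  /!-+ : ∀ a b p q r → a /! p , q , r ⊕ b /! p , q , r ≡ (a + b) /! p , q , r
  /!-+ a b p q r = /-+ a b (p ! · q ! · r !) {{factorials≢0 p q r}}

  /≡/! : ∀ {c p q r} a b .{{_ : NonZero b}} → a · (p ! · q ! · r !) ≡ c · b → + a / b ≡ c /! p , q , r
  /≡/! {c} {p} {q} {r} a b = /-cross a b c (p ! · q ! · r !) {{it}} {{factorials≢0 p q r}}

  /!-cross : ∀ {a p q r c s t u} → a · (s ! · t ! · u !) ≡ c · (p ! · q ! · r !) →
             a /! p , q , r ≡ c /! s , t , u
  /!-cross {a} {p} {q} {r} {c} {s} {t} {u} =
    /-cross a (p ! · q ! · r !) c (s ! · t ! · u !) {{factorials≢0 p q r}} {{factorials≢0 s t u}}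

/!-cong : ∀ {a a′ p p′ q q′ r r′} → a ≡ a′ → p ≡ p′ → q ≡ q′ → r ≡ r′ →
          a /! p , q , r ≡ a′ /! p′ , q′ , r′
/!-cong refl refl refl refl = refl

0/!≡0 : ∀ {a} p q r → a ≡ 0 → a /! p , q , r ≡ 0ℚ
0/!≡0 p q r refl = sym (/≡/! 0 1 refl)

-- Numerator and denominator both gain the factor `suc p`. This and its two analogues bring terms to
-- a common denominator.
/!-suc₁ : ∀ a p q r → a /! p , q , r ≡ (a · suc p) /! suc p , q , r
/!-suc₁ a p q r = /!-cross (arith a (suc p) (p !) (q !) (r !))
  where
  arith : ∀ a s x y z → a · (s · x · y · z) ≡ a · s · (x · y · z)
  arith = solve-∀

/!-suc₂ : ∀ a p q r → a /! p , q , r ≡ (a · suc q) /! p , suc q , r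
/!-suc₂ a p q r = /!-cross (arith a (suc q) (p !) (q !) (r !))
  where
  arith : ∀ a s x y z → a · (x · (s · y) · z) ≡ a · s · (x · y · z)
  arith = solve-∀

/!-suc₃ : ∀ a p q r → a /! p , q , r ≡ (a · suc r) /! p , q , suc r
/!-suc₃ a p q r = /!-cross (arith a (suc r) (p !) (q !) (r !))
  where
  arith : ∀ a s x y z → a · (x · y · (s · z)) ≡ a · s · (x · y · z)
  arith = solve-∀

-- The summand and its certificate.

-- The second binomial and the inverse one are expanded into factorials, and the divisor
-- `1 + (2 · m + n + k)` is absorbed into the last factorial. `m C n` stays whole, so that the term
-- vanishes for `n > m` and Pascal's rule can act on it.
F : ℕ → ℕ → ℕ → ℚ
F m k n = ((m C n) · ((m + n + k) ! · (n + m) ! · (m + k) ! · suc (m + 2 · n + k)))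
          /! m , n + k , suc (2 · m + n + k)

-- The factor `C⁻ m n` kills this at `n = 0` and at `n = m + 2`, the two ends of a telescoping over
-- `n ≤ m + 1`.
G : ℕ → ℕ → ℕ → ℚ
G m k n = (2 · (C⁻ m n · (suc (m + n + k) ! · (n + m) ! · suc (m + k) !)))
          /! m , n + k , suc (suc (2 · m + n + k))

F-original : ∀ m k n →
  binom m n * binom (m + n + k) m
  * binom⁻¹ (2 · m + n + k) (n + m) (n+m≤2m+n+k m n k)
  * (+ (1 + (m + 2 · n + k)) / (1 + (2 · m + n + k)))
  ≡ F m k n
F-original m k n = begin
  binom m n * binom (m + n + k) m * binom⁻¹ t (n + m) (n+m≤2m+n+k m n k) * (+ s / suc t)
    ≡⟨ cong (λ x → binom m n * binom (m + n + k) m * x * (+ s / suc t)) (binom⁻¹-/ t (n + m) (n+m≤2m+n+k m n k)) ⟩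
  (+ c / 1) * (+ d / 1) * (+ 1 / e) * (+ s / suc t)
    ≡⟨ cong (λ x → x * (+ 1 / e) * (+ s / suc t)) (/-* c 1 d 1) ⟩
  (+ (c · d) / 1) * (+ 1 / e) * (+ s / suc t)
    ≡⟨ cong (_* (+ s / suc t)) (/-* (c · d) 1 1 e) ⟩
  (+ (c · d · 1) / (1 · e)) * (+ s / suc t)
    ≡⟨ /-* (c · d · 1) (1 · e) s (suc t) ⟩
  + (c · d · 1 · s) / (1 · e · suc t)
    ≡⟨ /≡/! (c · d · 1 · s) (1 · e · suc t) cross ⟩
  F m k n ∎
  where
  open ≡-Reasoning
  c = m C n
  d = (m + n + k) C m
  t = 2 · m + n + k
  e = t C (n + m)
  s = suc (m + 2 · n + k)
  instance
    e≢0 : NonZero e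
    e≢0 = >-nonZero (C-positive t (n + m) (n+m≤2m+n+k m n k))
    1·e≢0 : NonZero (1 · e)
    1·e≢0 = ℕ.m*n≢0 1 e
    [1·e]·t≢0 : NonZero (1 · e · suc t)
    [1·e]·t≢0 = ℕ.m*n≢0 (1 · e) (suc t)
  d-! : d · (m ! · (n + k) !) ≡ (m + n + k) !
  d-! = subst (λ x → (x C m) · (m ! · (n + k) !) ≡ x !) (sym (ℕ.+-assoc m n k)) ([a+b]Ca·a!b!≡[a+b]! m (n + k))
  e-! : e · ((n + m) ! · (m + k) !) ≡ t !
  e-! = subst (λ x → (x C (n + m)) · ((n + m) ! · (m + k) !) ≡ x !) (eq m n k) ([a+b]Ca·a!b!≡[a+b]! (n + m) (m + k))
    where
    eq : ∀ m n k → (n + m) + (m + k) ≡ 2 · m + n + k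
    eq = solve-∀
  cross : c · d · 1 · s · (m ! · (n + k) ! · suc t !)
        ≡ c · ((m + n + k) ! · (n + m) ! · (m + k) ! · s) · (1 · e · suc t)
  -- Each upper factorial is traded for its binomial times the two lower factorials; what remains is
  -- a semiring identity in independent quantities.
  cross rewrite sym d-! | sym e-! =
    arith c d s (m !) ((n + k) !) (suc t) e ((n + m) !) ((m + k) !)
    where
    arith : ∀ c d s x y t e u v →
      c · d · 1 · s · (x · y · (t · (e · (u · v)))) ≡ c · (d · (x · y) · u · v · s) · (1 · e · t)
    arith = solve-∀

-- The recurrence over a common denominator.

module _ (m k n : ℕ) where

  private
    -- Slot by slot, `W` collects the smallest factorials in the numerators of the four terms of the
    -- recurrence, while `P`, `Q` and `R` index the largest ones in the denominators. Each cofactor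
    -- is then a polynomial times one binomial.
    W = suc (m + n + k) ! · (n + m) ! · suc (m + k) !
    P = suc m
    Q = suc (n + k)
    R = suc (suc (suc (2 · m + n + k)))

  F-suc-m : F (suc m) k n ≡
    (W · ((suc m C n) · suc (n + m) · Q · suc (suc (m + 2 · n + k)))) /! P , Q , R
  F-suc-m = trans (/!-suc₂ _ P (n + k) _) (/!-cong num refl refl (den m n k))
    where
    den : ∀ m n k → suc (2 · suc m + n + k) ≡ suc (suc (suc (2 · m + n + k)))
    den = solve-∀
    arith : ∀ c a s b e t q → c · (a · (s · b) · e · t) · q ≡ a · b · e · (c · s · q · t)
    arith = solve-∀
    num : (suc m C n) · (suc (m + n + k) ! · (n + suc m) ! · suc (m + k) ! · suc (suc (m + 2 · n + k))) · Q
        ≡ W · ((suc m C n) · suc (n + m) · Q · suc (suc (m + 2 · n + k)))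
    num rewrite ℕ.+-suc n m =
      arith (suc m C n) (suc (m + n + k) !) (suc (n + m)) ((n + m) !) (suc (m + k) !) _ Q

  F-suc-k : F m (suc k) n ≡
    (W · ((m C n) · suc m · R · suc (suc (m + 2 · n + k)))) /! P , Q , R
  F-suc-k = trans (/!-cong num refl (ℕ.+-suc n k) (cong suc (ℕ.+-suc (2 · m + n) k)))
    (trans (/!-suc₁ _ m Q _) (trans (/!-suc₃ _ P Q _)
    (/!-cong (arith (m C n) (suc (m + n + k) !) ((n + m) !) (suc (m + k) !) _ P R) refl refl refl)))
    where
    arith : ∀ c a b e t p r → c · (a · b · e · t) · p · r ≡ a · b · e · (c · p · r · t)
    arith = solve-∀
    num : (m C n) · ((m + n + suc k) ! · (n + m) ! · (m + suc k) ! · suc (m + 2 · n + suc k))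
        ≡ (m C n) · (suc (m + n + k) ! · (n + m) ! · suc (m + k) ! · suc (suc (m + 2 · n + k)))
    num rewrite ℕ.+-suc (m + n) k | ℕ.+-suc m k | ℕ.+-suc (m + 2 · n) k = refl

  G-common : G m k n ≡ (W · (2 · (C⁻ m n · suc m · Q · R))) /! P , Q , R
  G-common = trans (/!-suc₁ _ m (n + k) _) (trans (/!-suc₂ _ P (n + k) _) (trans (/!-suc₃ _ P Q _)
    (/!-cong (arith (C⁻ m n) W P Q R) refl refl refl)))
    where
    arith : ∀ c w p q r → 2 · (c · w) · p · q · r ≡ w · (2 · (c · p · q · r))
    arith = solve-∀

  G-suc-n : G m k (suc n) ≡
    (W · (2 · ((m C n) · suc m · suc (n + m) · suc (suc (m + n + k))))) /! P , Q , R
  G-suc-n = trans (/!-suc₁ _ m Q _) (/!-cong num refl refl (den m n k))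
    where
    den : ∀ m n k → suc (suc (2 · m + suc n + k)) ≡ suc (suc (suc (2 · m + n + k)))
    den = solve-∀
    arith : ∀ c a s b e t p → 2 · (c · (t · a · (s · b) · e)) · p ≡ a · b · e · (2 · (c · p · s · t))
    arith = solve-∀
    num : 2 · ((m C n) · (suc (m + suc n + k) ! · suc (n + m) ! · suc (m + k) !)) · suc m
        ≡ W · (2 · ((m C n) · suc m · suc (n + m) · suc (suc (m + n + k))))
    num rewrite ℕ.+-suc m n =
      arith (m C n) (suc (m + n + k) !) (suc (n + m)) ((n + m) !) (suc (m + k) !) (suc (suc (m + n + k))) P

  -- The two sides differ by q (n p - (m + 1) y); both products are moved so that
  -- no subtraction occurs.
  certificate : ∀ x y p → p ≡ x + y → n · p ≡ suc m · y →
      p · suc (n + m) · Q · suc (suc (m + 2 · n + k)) + 2 · (x · suc m · suc (n + m) · suc (suc (m + n + k)))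
    ≡ x · suc m · R · suc (suc (m + 2 · n + k)) + 2 · (y · suc m · Q · R)
  certificate x y p refl np≡My = ℕ.+-cancelʳ-≡ (q · (suc m · y)) _ _
    (trans (identity m n k x y) (cong (λ z → rhs + q · z) np≡My))
    where
    q = Q · suc (2 · n + 3 · suc m + k)
    rhs = x · suc m · R · suc (suc (m + 2 · n + k)) + 2 · (y · suc m · Q · R)
    identity : ∀ m n k x y →
        (x + y) · suc (n + m) · suc (n + k) · suc (suc (m + 2 · n + k))
        + 2 · (x · suc m · suc (n + m) · suc (suc (m + n + k)))
        + suc (n + k) · suc (2 · n + 3 · suc m + k) · (suc m · y)
      ≡ x · suc m · suc (suc (suc (2 · m + n + k))) · suc (suc (m + 2 · n + k))
        + 2 · (y · suc m · suc (n + k) · suc (suc (suc (2 · m + n + k))))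
        + suc (n + k) · suc (2 · n + 3 · suc m + k) · (n · (x + y))
    identity = solve-∀

  F-G : F (suc m) k n ⊕ G m k (suc n) ≡ F m (suc k) n ⊕ G m k n
  F-G = begin
    F (suc m) k n ⊕ G m k (suc n)    ≡⟨ cong₂ _⊕_ F-suc-m G-suc-n ⟩
    _                                ≡⟨ /!-+ (W · u) (W · v) P Q R ⟩
    (W · u + W · v) /! P , Q , R     ≡⟨ /!-cong num refl refl refl ⟩
    (W · u′ + W · v′) /! P , Q , R   ≡⟨ /!-+ (W · u′) (W · v′) P Q R ⟨
    _                                ≡⟨ cong₂ _⊕_ F-suc-k G-common ⟨
    F m (suc k) n ⊕ G m k n          ∎
    where
    open ≡-Reasoning
    u  = (suc m C n) · suc (n + m) · Q · suc (suc (m + 2 · n + k))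
    v  = 2 · ((m C n) · suc m · suc (n + m) · suc (suc (m + n + k)))
    u′ = (m C n) · suc m · R · suc (suc (m + 2 · n + k))
    v′ = 2 · (C⁻ m n · suc m · Q · R)
    num : W · u + W · v ≡ W · u′ + W · v′
    num = trans (sym (ℕ.*-distribˡ-+ W u v)) (trans
      -- With `W` factored out, Pascal's rule and absorption tie the three binomials together, and
      -- the rest is polynomial algebra.
      (cong (W ·_) (certificate (m C n) (C⁻ m n) (suc m C n) (pascal m n) (absorption m n)))
      (ℕ.*-distribˡ-+ W u′ v′))

-- Finite sums and telescoping.

∑-cong : ∀ m {f g : ℕ → ℚ} → (∀ n → f n ≡ g n) → ∑₀ m f ≡ ∑₀ m g
∑-cong zero    f≗g = cong (_⊕ 0ℚ) (f≗g 0)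
∑-cong (suc m) f≗g = cong₂ _⊕_ (f≗g 0) (∑-cong m (f≗g ∘ suc))

-- The sum unfolds at its first term, so detaching the last one takes an induction.
∑-last : ∀ m (f : ℕ → ℚ) → ∑₀ (suc m) f ≡ ∑₀ m f ⊕ f (suc m)
∑-last zero    f = trans (cong (f 0 ⊕_) (ℚ.+-identityʳ (f 1))) (cong (_⊕ f 1) (sym (ℚ.+-identityʳ (f 0))))
∑-last (suc m) f = trans (cong (f 0 ⊕_) (∑-last m (f ∘ suc))) (sym (ℚ.+-assoc (f 0) _ _))

-- Induction on the functions shifted by one leaves `g 1`, which `step 0` exchanges for `g 0` while
-- turning `f 0` into `h 0`.
∑-telescope : ∀ m (f h g : ℕ → ℚ) → (∀ n → f n ⊕ g (suc n) ≡ h n ⊕ g n) →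
              ∑₀ m f ⊕ g (suc m) ≡ ∑₀ m h ⊕ g 0
∑-telescope zero    f h g step = begin
  f 0 ⊕ 0ℚ ⊕ g 1    ≡⟨ cong (_⊕ g 1) (ℚ.+-identityʳ (f 0)) ⟩
  f 0 ⊕ g 1         ≡⟨ step 0 ⟩
  h 0 ⊕ g 0         ≡⟨ cong (_⊕ g 0) (ℚ.+-identityʳ (h 0)) ⟨
  h 0 ⊕ 0ℚ ⊕ g 0    ∎
  where open ≡-Reasoning
∑-telescope (suc m) f h g step = begin
  f 0 ⊕ Σf ⊕ g (2 + m)      ≡⟨ ℚ.+-assoc (f 0) Σf (g (2 + m)) ⟩
  f 0 ⊕ (Σf ⊕ g (2 + m))    ≡⟨ cong (f 0 ⊕_) (∑-telescope m (f ∘ suc) (h ∘ suc) (g ∘ suc) (step ∘ suc)) ⟩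
  f 0 ⊕ (Σh ⊕ g 1)          ≡⟨ cong (f 0 ⊕_) (ℚ.+-comm Σh (g 1)) ⟩
  f 0 ⊕ (g 1 ⊕ Σh)          ≡⟨ ℚ.+-assoc (f 0) (g 1) Σh ⟨
  f 0 ⊕ g 1 ⊕ Σh            ≡⟨ cong (_⊕ Σh) (step 0) ⟩
  h 0 ⊕ g 0 ⊕ Σh            ≡⟨ ℚ.+-assoc (h 0) (g 0) Σh ⟩
  h 0 ⊕ (g 0 ⊕ Σh)          ≡⟨ cong (h 0 ⊕_) (ℚ.+-comm (g 0) Σh) ⟩
  h 0 ⊕ (Σh ⊕ g 0)          ≡⟨ ℚ.+-assoc (h 0) Σh (g 0) ⟨
  h 0 ⊕ Σh ⊕ g 0            ∎
  where
  open ≡-Reasoning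
  Σf = ∑₀ m (f ∘ suc)
  Σh = ∑₀ m (h ∘ suc)

-- Reduction to `m = 0`.

∑F-shift : ∀ m k → ∑₀ (suc m) (F (suc m) k) ≡ ∑₀ m (F m (suc k))
∑F-shift m k = begin
  ∑₀ (suc m) (F (suc m) k)                         ≡⟨ ℚ.+-identityʳ _ ⟨
  ∑₀ (suc m) (F (suc m) k) ⊕ 0ℚ                    ≡⟨ cong (∑₀ (suc m) (F (suc m) k) ⊕_) G-top ⟨
  -- The range `n ≤ m + 1` is the natural one for `F (suc m) k` but one index too long for
  -- `F m (suc k)`, whose surplus term is zero by `F-top`.
  ∑₀ (suc m) (F (suc m) k) ⊕ G m k (suc (suc m))   ≡⟨ ∑-telescope (suc m) (F (suc m) k) (F m (suc k)) (G m k) (F-G m k) ⟩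
  ∑₀ (suc m) (F m (suc k)) ⊕ G m k 0               ≡⟨ cong (∑₀ (suc m) (F m (suc k)) ⊕_) (0/!≡0 m k (suc (suc (2 · m + 0 + k))) refl) ⟩
  ∑₀ (suc m) (F m (suc k)) ⊕ 0ℚ                    ≡⟨ ℚ.+-identityʳ _ ⟩
  ∑₀ (suc m) (F m (suc k))                         ≡⟨ ∑-last m (F m (suc k)) ⟩
  ∑₀ m (F m (suc k)) ⊕ F m (suc k) (suc m)         ≡⟨ cong (∑₀ m (F m (suc k)) ⊕_) F-top ⟩
  ∑₀ m (F m (suc k)) ⊕ 0ℚ                          ≡⟨ ℚ.+-identityʳ _ ⟩
  ∑₀ m (F m (suc k))                               ∎
  where
  open ≡-Reasoning
  mC[1+m]≡0 : m C suc m ≡ 0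
  mC[1+m]≡0 = k>n⇒nCk≡0 (ℕ.n<1+n m)
  vanishes : ∀ {c x} → c ≡ 0 → c · x ≡ 0
  vanishes refl = refl
  -- `C⁻ m (suc (suc m))` unfolds to `m C suc m`, so this boundary term and the surplus term vanish
  -- for the same reason.
  G-top : G m k (suc (suc m)) ≡ 0ℚ
  G-top = 0/!≡0 m _ _ (cong (2 ·_) (vanishes mC[1+m]≡0))
  F-top : F m (suc k) (suc m) ≡ 0ℚ
  F-top = 0/!≡0 m _ _ (vanishes mC[1+m]≡0)

-- Induction on `m` with `k` free: each shift moves one unit from `m` to `k`.
∑F≡1 : ∀ m k → ∑₀ m (F m k) ≡ 1ℚ
-- The only term is `k! · 0! · k! · (k + 1)` over `0! · k! · (k + 1)!`.
∑F≡1 zero    k = trans (ℚ.+-identityʳ (F 0 k 0)) (sym (/≡/! 1 1 (arith (k !) (suc k))))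
  where
  arith : ∀ x s → 1 · (1 · x · (s · x)) ≡ 1 · (x · 1 · x · s) · 1
  arith = solve-∀
∑F≡1 (suc m) k = trans (∑F-shift m k) (∑F≡1 m (suc k))

mainTheorem2 : (m k : ℕ) →
    ∑[ n ≤ m ] (binom m n
    * binom (m + n + k) m
    * binom⁻¹ (2 · m + n + k) (n + m) (n+m≤2m+n+k m n k)
    * (+ (1 + (m + 2 · n + k)) / (1 + (2 · m + n + k))))
    ≡ 1ℚ
mainTheorem2 m k = trans (∑-cong m (F-original m k)) (∑F≡1 m k)
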